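{- Fix $\alpha\in\{\text{rotor routing},\ \text{Bernardi}\}$, and for a ribbon graph $(H,\sigma)$ and $u\in V(H)$ write $\alpha_u^{H}:\operatorname{Pic}^0(H)\times\mathcal T(H)\to\mathcal T(H)$ for the corresponding sandpile torsor with basepoint $u$. There exist ribbon graphs $(G,\rho)$ and $(G',\rho')$ of genera $g$ and $g'$, with $V(G)=V(G')$, together with a bijection $\varphi:\mathcal T(G)\to\mathcal T(G')$ and a group isomorphism $\gamma:\operatorname{Pic}^0(G)\to\operatorname{Pic}^0(G')$, such that for every vertex $v\in V(G)$, every $S\in\operatorname{Pic}^0(G)$ and every $T\in\mathcal T(G)$, $$\varphi\big(\alpha_v^{G}(S,T)\big)=\alpha_v^{G'}\big(\gamma(S),\varphi(T)\big),$$ and such that $g\neq g'$.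
   Context: Graphs are finite and connected, may have multiple edges, and have no loops. $\mathcal T(G)$ is the set of spanning trees of $G$ (as subsets of $E(G)$). A ribbon graph $(G,\rho)$ is a graph $G$ together with, for each vertex $u$, a cyclic order $\rho_u$ on the edges incident to $u$. $\operatorname{Div}^0(G)$ is the group of integer vectors $\sum_u n_u u$ with $\sum n_u=0$ (chip configurations); firing a vertex $u$ moves one chip from $u$ along each edge incident to $u$; $\operatorname{Pic}^0(G)=\operatorname{Div}^0(G)/\operatorname{im}(\Delta)$, where $\Delta$ is the graph Laplacian, i.e. two degree-zero divisors are equivalent iff they differ by an integer combination of firings. More generally $\operatorname{Pic}^k(G)$ is the set of degree-$k$ divisors modulo the same equivalence. Rotor routing torsor $r_v$ (basepoint $v$): for $S\in\operatorname{Pic}^0(G)$ and $T\in\mathcal T(G)$, choose a representative of $S$ with nonnegative chips at every vertex other than $v$; orient $T$ towards $v$, so each $u\neq v$ has one outgoing edge (its rotor). While some $u\neq v$ has a positive number of chips, pick such a $u$, advance its rotor to the next edge in $\rho_u$, and send one chip from $u$ along this new rotor edge to its other endpoint. When all vertices other than $v$ have zero chips, the rotors (unoriented) form a spanning tree $r_v(S,T)$; this is independent of all choices and defines a free transitive action. Bernardi torsor $\beta_v$: an edge $e$ with endpoints $u_1,u_2$ has half-edges $(e,u_1),(e,u_2)$. For $T\in\mathcal T(G)$, fix an edge $e_0$ incident to $v$ and start at the half-edge $(e_0,v)$. At current half-edge $(e',v')$: if $e'\in T$, let $w'$ be the other endpoint of $e'$ and move to $(e'',w')$ where $e''$ follows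 $e'$ in $\rho_{w'}$; if $e'\notin T$, move to $(\tilde e,v')$ where $\tilde e$ follows $e'$ in $\rho_{v'}$, and place a chip on $v'$ if the other half-edge of $e'$ has not yet been visited. Stop on returning to $(e_0,v)$. The resulting divisor $D_T$ has degree $|E(G)|-|V(G)|+1=:k$; the classes $[D_T]\in\operatorname{Pic}^k(G)$ are distinct for distinct $T$ and exhaust $\operatorname{Pic}^k(G)$, and $\beta_v(S,T)$ is the unique $T'$ with $[D_{T'}]=[D_T]+S$ (independent of $e_0$). Genus: a cycle (face) of $(G,\rho)$ is a closed walk such that whenever it enters a vertex $u$ along an edge $e$ it leaves along the edge following $e$ in $\rho_u$; equivalently an orbit of the permutation of half-edges sending (edge $e$ leaving $u$ towards $u'$) to (edge following $e$ in $\rho_{u'}$, leaving $u'$). With $\operatorname{cyc}(G,\rho)$ the number of cycles, the genus $g$ of $(G,\rho)$ (the genus of the associated closed surface) satisfies $2g=2-|V(G)|+|E(G)|-\operatorname{cyc}(G,\rho)$. -}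

module Defs where

open import Algebra.Bundles using (AbelianGroup)
open import Algebra.Properties.CommutativeMonoid.Sum using (sum; ∑-distrib-+; sum-cong-≋; sum-replicate-zero)
open import Data.Bool using (Bool; true; false; not; if_then_else_; _∨_)
import Data.Bool.Properties as Bool
open import Data.Fin using (Fin; zero; suc)
import Data.Fin.Properties as Fin
open import Data.Fin.Subset using (Subset; ⊤; _∈_)
open import Data.Fin.Subset.Properties using (_∈?_)
open import Data.Integer using (ℤ; 0ℤ; 1ℤ; _+_; _-_; _*_; -_; _≤_; _<_)
import Data.Integer.Properties as ℤ
open import Data.Integer.Tactic.RingSolver using (solve-∀)
open import Data.List using (List; []; _∷_)
import Data.List.Membership.DecPropositional as DecMembership
open import Data.List.Relation.Unary.Unique.Propositional using (Unique)
open import Data.Nat as ℕ using (ℕ; zero; suc; NonZero)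
open import Data.Nat.GeneralisedArithmetic using (iterate)
open import Data.Product using (Σ; ∃; _×_; _,_; proj₁; proj₂)
open import Data.Product.Properties using (≡-dec)
open import Function.Bundles using (_⇔_; _↠_; module Surjection)
open import Level using (0ℓ)
open import Relation.Binary using (Setoid; Rel; DecidableEquality)
import Relation.Binary.Construct.On as On
open import Relation.Binary.Construct.Closure.ReflexiveTransitive using (Star)
open import Relation.Binary.PropositionalEquality
open import Relation.Nullary using (¬_; does)

-- Edge e has the two half-edges (e , false) and (e , true).  In a loopless
-- graph a half-edge is the same thing as a pair (e , u) with e incident to u.
HalfEdge : ℕ → Set
HalfEdge m = Fin m × Bool

_≟ₕ_ : ∀ {m} → DecidableEquality (HalfEdge m)
_≟ₕ_ = ≡-dec Fin._≟_ Bool._≟_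

edge : ∀ {m} → HalfEdge m → Fin m
edge = proj₁

opp : ∀ {m} → HalfEdge m → HalfEdge m
opp (e , s) = e , not s

module Walks {n m : ℕ} (at : HalfEdge m → Fin n) where

  data Walk (T : Subset m) : Fin n → Fin n → Set where
    []   : ∀ {u} → Walk T u u
    step : ∀ {u w} (h : HalfEdge m) → edge h ∈ T → at h ≡ u →
           Walk T (at (opp h)) w → Walk T u w

  edges : ∀ {T u w} → Walk T u w → List (Fin m)
  edges []             = []
  edges (step h _ _ p) = edge h ∷ edges p

  -- The final vertex is left out, so that the repetition at the end of a
  -- closed walk is not counted.
  vertices : ∀ {T u w} → Walk T u w → List (Fin n)
  vertices []             = []
  vertices (step h _ _ p) = at h ∷ vertices p

  Connected : Subset m → Set
  Connected T = ∀ u w → Walk T u w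

  record IsCycle {T u} (p : Walk T u u) : Set where
    field
      nonEmpty         : ¬ edges p ≡ []
      distinctEdges    : Unique (edges p)
      distinctVertices : Unique (vertices p)

  Acyclic : Subset m → Set
  Acyclic T = ∀ {u} (p : Walk T u u) → ¬ IsCycle p

-- Finite connected loopless multigraphs with vertex set Fin n.
record Graph (n : ℕ) : Set where
  field
    size      : ℕ
    at        : HalfEdge size → Fin n
    nonEmpty  : NonZero n
    loopless  : ∀ h → at h ≢ at (opp h)
    connected : Walks.Connected at ⊤

  open Walks at public

  head : HalfEdge size → Fin n
  head h = at (opp h)

  record IsSpanningTree (T : Subset size) : Set where
    field
      treeConnected : Connected T
      treeAcyclic   : Acyclic T

  SpanningTree : Set
  SpanningTree = Σ (Subset size) IsSpanningTree

  -- Spanning trees are compared as sets of edges.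
  𝒯 : Setoid 0ℓ 0ℓ
  𝒯 = On.setoid {B = SpanningTree} (setoid (Subset size)) proj₁

-- The cyclic orders are given by their successor function: ρ sends (e , u) to
-- (e′ , u), where e′ follows e around u.  By `cyclic`, the half-edges at any
-- one vertex form a single cycle; in particular ρ is a permutation.
record RibbonGraph (n : ℕ) : Set where
  field
    graph  : Graph n
  open Graph graph public
  field
    ρ      : HalfEdge size → HalfEdge size
    at-ρ   : ∀ h → at (ρ h) ≡ at h
    cyclic : ∀ h h′ → at h ≡ at h′ → ∃ λ k → iterate ρ h k ≡ h′

module _ {n : ℕ} (G : RibbonGraph n) where
  open RibbonGraph G

  -- The half-edge h stands for its edge being traversed from at h to head h.
  face : HalfEdge size → HalfEdge size
  face h = ρ (opp h)

  -- cyc(G , ρ) = k: the orbits of `face` are the fibres of a surjection onto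
  -- Fin k.
  HasCycles : ℕ → Set
  HasCycles k = Σ (HalfEdge size ↠ Fin k) λ c → ∀ h h′ →
    (Surjection.to c h ≡ Surjection.to c h′) ⇔ (∃ λ i → iterate face h i ≡ h′)

  -- 2g = 2 - |V| + |E| - cyc, with the subtracted terms moved to the left.
  -- The one-vertex graph has no half-edge, hence no orbit, and so no genus in
  -- this sense.
  HasGenus : ℕ → Set
  HasGenus g = ∃ λ k → HasCycles k × 2 ℕ.* g ℕ.+ n ℕ.+ k ≡ 2 ℕ.+ size

private
  ℤ⁺ = ℤ.+-0-commutativeMonoid

Divisor : ℕ → Set
Divisor n = Fin n → ℤ

degree : ∀ {n} → Divisor n → ℤ
degree = sum ℤ⁺

infixl 6 _⊕_
_⊕_ : ∀ {n} → Divisor n → Divisor n → Divisor n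
(D ⊕ E) u = D u + E u

⊖_ : ∀ {n} → Divisor n → Divisor n
(⊖ D) u = - D u

𝟎 : ∀ {n} → Divisor n
𝟎 _ = 0ℤ

⟦_⟧ : ∀ {n} → Fin n → Divisor n
⟦ u ⟧ w = if does (u Fin.≟ w) then 1ℤ else 0ℤ

private
  sum-neg : ∀ n (f : Fin n → ℤ) → sum ℤ⁺ (λ i → - f i) ≡ - sum ℤ⁺ f
  sum-neg zero    f = refl
  sum-neg (suc n) f =
    trans (cong ((- f zero) +_) (sum-neg n (λ i → f (suc i))))
          (sym (ℤ.neg-distrib-+ (f zero) _))

  sum-zero : ∀ n → sum ℤ⁺ {n} (λ _ → 0ℤ) ≡ 0ℤ
  sum-zero n = sum-replicate-zero ℤ⁺ n

module _ {n : ℕ} (G : Graph n) where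
  open Graph G

  flow : (Fin n → ℤ) → Fin n → HalfEdge size → ℤ
  flow f w h = ⟦ at h ⟧ w * (f (head h) - f (at h))

  -- Change in the number of chips at w when each vertex u fires f u times:
  -- each half-edge h at w brings f (head h) chips and takes away f w chips.
  Δ : (Fin n → ℤ) → Divisor n
  Δ f w = sum ℤ⁺ λ e → flow f w (e , false) + flow f w (e , true)

  infix 4 _∼_
  _∼_ : Rel (Divisor n) 0ℓ
  D ∼ E = ∃ λ f → ∀ w → E w ≡ D w + Δ f w

  Div⁰ : Set
  Div⁰ = Σ (Divisor n) λ D → degree D ≡ 0ℤ

  private
    Δ-zero : ∀ w → Δ 𝟎 w ≡ 0ℤ
    Δ-zero w = trans
      (sum-cong-≋ ℤ⁺ λ e →
        lem (⟦ at (e , false) ⟧ w) (⟦ at (e , true) ⟧ w))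
      (sum-zero size)
      where
      lem : ∀ a b → a * (0ℤ - 0ℤ) + b * (0ℤ - 0ℤ) ≡ 0ℤ
      lem = solve-∀

    Δ-neg : ∀ f w → Δ (⊖ f) w ≡ - Δ f w
    Δ-neg f w = trans
      (sum-cong-≋ ℤ⁺ λ e →
        lem (⟦ at (e , false) ⟧ w) (⟦ at (e , true) ⟧ w)
            (f (at (e , false))) (f (at (e , true))))
      (sum-neg size (λ e → flow f w (e , false) + flow f w (e , true)))
      where
      lem : ∀ a b x y → a * (- y - - x) + b * (- x - - y)
                      ≡ - (a * (y - x) + b * (x - y))
      lem = solve-∀

    Δ-add : ∀ f g w → Δ (f ⊕ g) w ≡ Δ f w + Δ g w
    Δ-add f g w = trans
      (sum-cong-≋ ℤ⁺ λ e →
        lem (⟦ at (e , false) ⟧ w) (⟦ at (e , true) ⟧ w)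
            (f (at (e , false))) (f (at (e , true)))
            (g (at (e , false))) (g (at (e , true))))
      (∑-distrib-+ ℤ⁺ {size} _ _)
      where
      lem : ∀ a b x y x′ y′ →
            a * ((y + y′) - (x + x′)) + b * ((x + x′) - (y + y′))
            ≡ (a * (y - x) + b * (x - y)) + (a * (y′ - x′) + b * (x′ - y′))
      lem = solve-∀

    ≗⇒∼ : ∀ D E → (∀ w → E w ≡ D w) → D ∼ E
    ≗⇒∼ D E eq = 𝟎 , λ w →
      trans (eq w) (sym (trans (cong (D w +_) (Δ-zero w)) (ℤ.+-identityʳ _)))

    ∼-sym : ∀ D E → D ∼ E → E ∼ D
    ∼-sym D E (f , p) = ⊖ f , λ w →
      sym (trans (cong₂ _+_ (p w) (Δ-neg f w)) (lem (D w) (Δ f w)))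
      where
      lem : ∀ a b → (a + b) + - b ≡ a
      lem = solve-∀

    ∼-trans : ∀ D E F → D ∼ E → E ∼ F → D ∼ F
    ∼-trans D _ _ (f , p) (g , q) = f ⊕ g , λ w →
      trans (q w) (trans (cong (_+ Δ g w) (p w))
        (trans (ℤ.+-assoc (D w) (Δ f w) (Δ g w))
               (cong (D w +_) (sym (Δ-add f g w)))))

    ⊕-cong : ∀ D D′ E E′ → D ∼ D′ → E ∼ E′ → (D ⊕ E) ∼ (D′ ⊕ E′)
    ⊕-cong D _ E _ (f , p) (g , q) = f ⊕ g , λ w →
      trans (cong₂ _+_ (p w) (q w))
        (trans (lem (D w) (Δ f w) (E w) (Δ g w))
               (cong (D w + E w +_) (sym (Δ-add f g w))))
      where
      lem : ∀ a b c d → (a + b) + (c + d) ≡ (a + c) + (b + d)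
      lem = solve-∀

    ⊖-cong : ∀ D E → D ∼ E → (⊖ D) ∼ (⊖ E)
    ⊖-cong D _ (f , p) = ⊖ f , λ w →
      trans (cong -_ (p w))
        (trans (ℤ.neg-distrib-+ (D w) (Δ f w))
               (cong (- D w +_) (sym (Δ-neg f w))))

  Pic⁰ : AbelianGroup 0ℓ 0ℓ
  Pic⁰ = record
    { Carrier = Div⁰
    ; _≈_     = λ S S′ → proj₁ S ∼ proj₁ S′
    ; _∙_     = λ (D , p) (E , q) →
        D ⊕ E , trans (∑-distrib-+ ℤ⁺ D E) (cong₂ _+_ p q)
    ; ε       = 𝟎 , sum-zero n
    ; _⁻¹     = λ (D , p) → ⊖ D , trans (sum-neg n D) (cong -_ p)
    ; isAbelianGroup = record
      { isGroup = record
        { isMonoid = record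
          { isSemigroup = record
            { isMagma = record
              { isEquivalence = record
                { refl  = ≗⇒∼ _ _ λ _ → refl
                ; sym   = λ {S} {S′} → ∼-sym (proj₁ S) (proj₁ S′)
                ; trans = λ {S} {S′} {S″} → ∼-trans (proj₁ S) (proj₁ S′) (proj₁ S″)
                }
              ; ∙-cong = λ {S} {S′} {U} {U′} →
                  ⊕-cong (proj₁ S) (proj₁ S′) (proj₁ U) (proj₁ U′)
              }
            ; assoc = λ (D , _) (E , _) (F , _) →
                ≗⇒∼ _ _ λ w → sym (ℤ.+-assoc (D w) (E w) (F w))
            }
          ; identity = (λ (D , _) → ≗⇒∼ _ _ λ w → sym (ℤ.+-identityˡ (D w)))
                     , (λ (D , _) → ≗⇒∼ _ _ λ w → sym (ℤ.+-identityʳ (D w)))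
          }
        ; inverse = (λ (D , _) → ≗⇒∼ _ _ λ w → sym (ℤ.+-inverseˡ (D w)))
                  , (λ (D , _) → ≗⇒∼ _ _ λ w → sym (ℤ.+-inverseʳ (D w)))
        ; ⁻¹-cong = λ {S} {S′} → ⊖-cong (proj₁ S) (proj₁ S′)
        }
      ; comm = λ (D , _) (E , _) → ≗⇒∼ _ _ λ w → ℤ.+-comm (E w) (D w)
      }
    }

module _ {n : ℕ} (G : RibbonGraph n) where
  open RibbonGraph G

  private
    infix 4 _~_
    _~_ : Rel (Divisor n) 0ℓ
    _~_ = _∼_ graph

  -- Families of maps (S , T) ↦ α_v(S , T), indexed by the basepoint v.
  Action : Set
  Action = Fin n → Div⁰ graph → SpanningTree → SpanningTree

  Rotors : Fin n → Set
  Rotors v = ∀ u → .(u ≢ v) → HalfEdge size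

  State : Fin n → Set
  State v = Divisor n × Rotors v

  IsEdgeSet : ∀ {v} → Rotors v → Subset size → Set
  IsEdgeSet {v} R X = ∀ e → e ∈ X ⇔ (Σ (Fin n) λ u → Σ (u ≢ v) λ u≢v → edge (R u u≢v) ≡ e)

  -- R is the tree T oriented towards v.
  record Orients {v} (R : Rotors v) (T : Subset size) : Set where
    field
      outgoing : ∀ u (u≢v : u ≢ v) → at (R u u≢v) ≡ u
      edgeSet  : IsEdgeSet R T
      towards  : ∀ u → Star (λ x y → Σ (x ≢ v) λ x≢v → head (R x x≢v) ≡ y) u v

  route : ∀ {v} (u : Fin n) → u ≢ v → State v → State v
  route {v} u u≢v (D , R) = D ⊕ ⊖ ⟦ u ⟧ ⊕ ⟦ head h ⟧ , R′
    where
    h : HalfEdge size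
    h = ρ (R u u≢v)
    R′ : Rotors v
    R′ w w≢v = if does (u Fin.≟ w) then h else R w w≢v

  data Move {v} : Rel (State v) 0ℓ where
    move : ∀ {D R} u (u≢v : u ≢ v) → 0ℤ < D u → Move (D , R) (route u u≢v (D , R))

  -- Some run of the procedure with basepoint v, started from S and T, ends
  -- with rotors whose set of edges is X.
  record RotorRoutes (v : Fin n) (S : Div⁰ graph) (T : SpanningTree) (X : Subset size) : Set where
    field
      chips           : Divisor n
      represents      : chips ~ proj₁ S
      nonNegative     : ∀ u → u ≢ v → 0ℤ ≤ chips u
      rotors          : Rotors v
      orients         : Orients rotors (proj₁ T)
      finalChips      : Divisor n
      finalRotors     : Rotors v
      run             : Star Move (chips , rotors) (finalChips , finalRotors)
      noChips         : ∀ u → u ≢ v → finalChips u ≡ 0ℤ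
      finalEdges      : IsEdgeSet finalRotors X

  -- r v S T is the outcome of some run, and of every run that ends.
  IsRotorRouting : Action → Set
  IsRotorRouting r = ∀ v S T X → RotorRoutes v S T X ⇔ (X ≡ proj₁ (r v S T))

  module _ (T : Subset size) where

    open DecMembership (_≟ₕ_ {size}) using () renaming (_∈?_ to _∈ₗ?_)

    next : HalfEdge size → HalfEdge size
    next h = if does (edge h ∈? T) then ρ (opp h) else ρ h

    placed : List (HalfEdge size) → HalfEdge size → Divisor n
    placed visited h =
      if does (edge h ∈? T) ∨ does (opp h ∈ₗ? visited) then 𝟎 else ⟦ at h ⟧

    module _ (h₀ : HalfEdge size) where

      -- The first argument bounds the number of steps.
      tour : ℕ → List (HalfEdge size) → HalfEdge size → Divisor n
      tour zero    visited h = 𝟎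
      tour (suc k) visited h = placed visited h ⊕
        (if does (next h ≟ₕ h₀) then 𝟎 else tour k (h ∷ visited) (next h))

      -- As `next` permutes the 2 |E| half-edges, the tour returns to h₀
      -- within 2 |E| steps, so the bound does not cut it short.
      bernardiDivisor : Divisor n
      bernardiDivisor = tour (2 ℕ.* size) [] h₀

  -- The divisors may be computed from any half-edge h₀ at v.
  IsBernardi : Action → Set
  IsBernardi β = ∀ v S (T T′ : SpanningTree) h₀ → at h₀ ≡ v →
    (bernardiDivisor (proj₁ T′) h₀ ~ bernardiDivisor (proj₁ T) h₀ ⊕ proj₁ S)
    ⇔ (proj₁ T′ ≡ proj₁ (β v S T))

data TorsorKind : Set where
  rotorRouting bernardi : TorsorKind

IsTorsorOf : TorsorKind → ∀ {n} (G : RibbonGraph n) → Action G → Set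
IsTorsorOf rotorRouting = IsRotorRouting
IsTorsorOf bernardi     = IsBernardi

{-# OPTIONS --safe #-}

-- Both graphs are two vertices joined by five edges: spanning trees are single
-- edges, and Pic⁰ = ℤ/5 via the chips at one vertex modulo 5.  Write S for the
-- class of [0] − [1] and ρ_w for the cyclic order at w.  Then S acts by ρ_0 in
-- r_1 and β_0, and −S acts by ρ_1 in r_0 and β_1.  Hence ρ_w = (ρ′_w)² at both
-- vertices makes φ = id and γ = (multiplication by 2) compatible with either
-- torsor.  But the faces correspond to the cycles of ρ_0 ρ_1, and their number
-- need not survive squaring: it is 3 for ρ and 1 for ρ′.
module Submission where

open import Defs
open import Algebra.Bundles using (module AbelianGroup)
open import Algebra.Properties.CommutativeMonoid.Sum using (∑-distrib-+)
open import Algebra.Morphism.Structures using (module GroupMorphisms)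
open import Data.Fin using (Fin)
open import Data.Nat using (ℕ)
open import Data.Product using (Σ; _×_; proj₁)
open import Function.Bundles using (Bijection)
open import Relation.Binary.Bundles using (module Setoid)
open import Relation.Binary.PropositionalEquality using (_≢_)
open AbelianGroup using (rawGroup)
open GroupMorphisms using (IsGroupIsomorphism)
open Setoid using () renaming (_≈_ to Eq)
open RibbonGraph using (graph; 𝒯; SpanningTree)

import Algebra.Properties.AbelianGroup as AbelianGroupProperties
import Algebra.Properties.CommutativeSemigroup as CommutativeSemigroupProperties
open import Data.Bool using (Bool; true; false; if_then_else_)
open import Data.Fin using (zero; suc; toℕ; fromℕ<; #_)
open import Data.Fin.Permutation using (Permutation′; _⟨$⟩ʳ_; _⟨$⟩ˡ_; inverseˡ; inverseʳ; _∘ₚ_; permutation; transpose)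
  renaming (id to idₚ)
open import Data.Fin.Properties using (_≟_; all?; any?; toℕ-fromℕ<)
open import Data.Fin.Subset using (⁅_⁆; _∈_)
open import Data.Fin.Subset.Properties using (x∈⁅x⁆; x∈⁅y⁆⇒x≡y; ⊆-antisym; ∈⊤)
open import Data.Integer using (ℤ; +_; 0ℤ; 1ℤ; _+_; _-_; _*_; -_; _<_; _≤_; +<+; +≤+)
open import Data.Integer.DivMod using (_%ℕ_; _/ℕ_; n%ℕd<d; a≡a%ℕn+[a/ℕn]*n)
open import Data.Integer.Divisibility.Signed using (_∣_; divides; _∣?_; ∣m∣n⇒∣m+n; ∣m⇒∣-m;
  ∣m∣n⇒∣m-n; ∣n⇒∣m*n)
import Data.Integer.Properties as ℤ
open import Data.Integer.Tactic.RingSolver using (solve-∀)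
open import Data.List using ([])
open import Data.List.Relation.Unary.All using ([]; _∷_)
open import Data.List.Relation.Unary.AllPairs using ([]; _∷_)
open import Data.List.Relation.Unary.Unique.Propositional using (Unique)
open import Data.Nat as ℕ using (zero; suc; s≤s; z≤n)
open import Data.Nat.GeneralisedArithmetic using (iterate)
open import Data.Product using (∃; _,_; proj₂)
open import Function.Base using (_∘_)
open import Function.Bundles using (_⇔_; mk⇔; mk↠ₛ; module Equivalence)
import Function.Construct.Identity as Identity
open import Relation.Binary.Construct.Closure.ReflexiveTransitive using (Star; ε; _◅_)
open import Relation.Binary.PropositionalEquality
open import Relation.Nullary using (yes; no; contradiction; ¬_; Dec)
open import Relation.Nullary.Decidable using (from-yes; map′; _→-dec_; _×-dec_; dec-true)

-- Congruence of integers modulo 5.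

infix 4 _≡₅_ _≡₅?_
-- A record rather than a synonym, so that both sides can be inferred; they could not be recovered
-- from `b - a` alone.
record _≡₅_ (a b : ℤ) : Set where
  constructor mod₅
  field difference : + 5 ∣ b - a

_≡₅?_ : ∀ a b → Dec (a ≡₅ b)
a ≡₅? b = map′ mod₅ _≡₅_.difference (+ 5 ∣? b - a)

≡⇒≡₅ : ∀ {a b} → a ≡ b → a ≡₅ b
≡⇒≡₅ {a} refl = mod₅ (divides 0ℤ (ℤ.+-inverseʳ a))

≡₅-refl : ∀ {a} → a ≡₅ a
≡₅-refl = ≡⇒≡₅ refl

≡₅-sym : ∀ {a b} → a ≡₅ b → b ≡₅ a
≡₅-sym {a} {b} (mod₅ p) = mod₅ (subst (+ 5 ∣_) (lem a b) (∣m⇒∣-m p))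
  where
  lem : ∀ a b → - (b - a) ≡ a - b
  lem = solve-∀

≡₅-trans : ∀ {a b c} → a ≡₅ b → b ≡₅ c → a ≡₅ c
≡₅-trans {a} {b} {c} (mod₅ p) (mod₅ q) = mod₅ (subst (+ 5 ∣_) (lem a b c) (∣m∣n⇒∣m+n p q))
  where
  lem : ∀ a b c → (b - a) + (c - b) ≡ c - a
  lem = solve-∀

+-congˡ₅ : ∀ a {b c} → b ≡₅ c → a + b ≡₅ a + c
+-congˡ₅ a {b} {c} (mod₅ p) = mod₅ (subst (+ 5 ∣_) (lem a b c) p)
  where
  lem : ∀ a b c → c - b ≡ (a + c) - (a + b)
  lem = solve-∀

+-congʳ₅ : ∀ a {b c} → b ≡₅ c → b + a ≡₅ c + a
+-congʳ₅ a {b} {c} (mod₅ p) = mod₅ (subst (+ 5 ∣_) (lem a b c) p)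
  where
  lem : ∀ a b c → c - b ≡ (c + a) - (b + a)
  lem = solve-∀

+-cancelˡ₅ : ∀ a {b c} → a + b ≡₅ a + c → b ≡₅ c
+-cancelˡ₅ a {b} {c} (mod₅ p) = mod₅ (subst (+ 5 ∣_) (lem a b c) p)
  where
  lem : ∀ a b c → (a + c) - (a + b) ≡ c - b
  lem = solve-∀

-- 3 inverts 2 modulo 5: for d = b - a, three times 2d minus 5d is d.
double-cancel₅ : ∀ {a b} → a + a ≡₅ b + b → a ≡₅ b
double-cancel₅ {a} {b} (mod₅ p) = mod₅
  (subst (+ 5 ∣_) (lem a b) (∣m∣n⇒∣m-n (∣n⇒∣m*n (+ 3) p) (divides (b - a) refl)))
  where
  lem : ∀ a b → + 3 * ((b + b) - (a + a)) - (b - a) * + 5 ≡ b - a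
  lem = solve-∀

toℕ-injective₅ : ∀ i j → + toℕ {5} i ≡₅ + toℕ j → i ≡ j
toℕ-injective₅ = from-yes (all? λ i → all? λ j → (+ toℕ {5} i ≡₅? + toℕ j) →-dec (i ≟ j))

residue : ℤ → Fin 5
residue a = fromℕ< (n%ℕd<d a 5)

residue≡₅ : ∀ a → + toℕ (residue a) ≡₅ a
residue≡₅ a = mod₅ (divides (a /ℕ 5) (begin
  a - + toℕ (residue a)                          ≡⟨ cong (λ r → a - + r) (toℕ-fromℕ< (n%ℕd<d a 5)) ⟩
  a - r                                          ≡⟨ cong (_- r) (a≡a%ℕn+[a/ℕn]*n a 5) ⟩
  (r + a /ℕ 5 * + 5) - r                         ≡⟨ lem r (a /ℕ 5 * + 5) ⟩
  a /ℕ 5 * + 5                                   ∎))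
  where
  open ≡-Reasoning
  r = + (a %ℕ 5)
  lem : ∀ r q → (r + q) - r ≡ q
  lem = solve-∀

-- The graph with two vertices and five parallel edges.

vertex : Bool → Fin 2
vertex false = zero
vertex true  = suc zero

vertex-injective : ∀ s s′ → vertex s ≡ vertex s′ → s ≡ s′
vertex-injective false false _ = refl
vertex-injective true  true  _ = refl

side : Fin 2 → Bool
side zero       = false
side (suc zero) = true

vertex-side : ∀ u → vertex (side u) ≡ u
vertex-side zero       = refl
vertex-side (suc zero) = refl

other : Fin 2 → Fin 2
other zero       = suc zero
other (suc zero) = zero

other≢ : ∀ v → other v ≢ v
other≢ zero       ()
other≢ (suc zero) ()

≢⇒≡other : ∀ {u} v → u ≢ v → u ≡ other v
≢⇒≡other {zero}     zero       u≢v = contradiction refl u≢v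
≢⇒≡other {zero}     (suc zero) u≢v = refl
≢⇒≡other {suc zero} zero       u≢v = refl
≢⇒≡other {suc zero} (suc zero) u≢v = contradiction refl u≢v

ends : HalfEdge 5 → Fin 2
ends (_ , s) = vertex s

banana : Graph 2
banana = record
  { size      = 5
  ; at        = ends
  ; nonEmpty  = _
  ; loopless  = λ { (_ , false) () ; (_ , true) () }
  ; connected = λ
    { zero       zero       → []
    ; zero       (suc zero) → step (zero , false) ∈⊤ refl []
    ; (suc zero) zero       → step (zero , true) ∈⊤ refl []
    ; (suc zero) (suc zero) → []
    }
  }
  where open Walks ends

ends-opp : ∀ h → ends (opp h) ≡ other (ends h)
ends-opp (_ , false) = refl
ends-opp (_ , true)  = refl

open Graph banana using (Walk; []; step; edges; IsCycle; IsSpanningTree)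
  renaming (SpanningTree to Tree)

-- Linear equivalence of divisors on this graph.

infix 4 _~_
_~_ = _∼_ banana

-- Each of the five edges has exactly one half-edge at `w`, and all contribute the same amount `z`;
-- the unfolded sum is then a ring identity.
Δ-banana : ∀ f w → Δ banana f w ≡ (f (other w) - f w) * + 5
Δ-banana f zero       = lem (f zero) (f (suc zero))
  where
  lem : ∀ x y →
    let z = 1ℤ * (y - x) + 0ℤ * (x - y) in
    z + (z + (z + (z + (z + 0ℤ)))) ≡ (y - x) * + 5
  lem = solve-∀
Δ-banana f (suc zero) = lem (f zero) (f (suc zero))
  where
  lem : ∀ x y →
    let z = 0ℤ * (y - x) + 1ℤ * (x - y) in
    z + (z + (z + (z + (z + 0ℤ)))) ≡ (x - y) * + 5
  lem = solve-∀

~⇒≡₅ : ∀ {D E} → D ~ E → ∀ w → D w ≡₅ E w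
~⇒≡₅ {D} {E} (f , eq) w = mod₅ (divides (f (other w) - f w) (begin
  E w - D w                         ≡⟨ cong (_- D w) (eq w) ⟩
  (D w + Δ banana f w) - D w        ≡⟨ lem (D w) (Δ banana f w) ⟩
  Δ banana f w                      ≡⟨ Δ-banana f w ⟩
  (f (other w) - f w) * + 5         ∎))
  where
  open ≡-Reasoning
  lem : ∀ a b → (a + b) - a ≡ b
  lem = solve-∀

degree-banana : ∀ (D : Divisor 2) w → degree D ≡ D w + D (other w)
degree-banana D zero       = cong (_+_ (D zero)) (ℤ.+-identityʳ _)
degree-banana D (suc zero) = trans (degree-banana D zero) (ℤ.+-comm (D zero) _)

other-other : ∀ w → other (other w) ≡ w
other-other zero       = refl
other-other (suc zero) = refl

⟦⟧-at : ∀ {n} (u : Fin n) → ⟦ u ⟧ u ≡ 1ℤ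
⟦⟧-at u = cong (if_then 1ℤ else 0ℤ) (dec-true (u ≟ u) refl)

⟦other⟧-at : ∀ u → ⟦ other u ⟧ u ≡ 0ℤ
⟦other⟧-at zero       = refl
⟦other⟧-at (suc zero) = refl

-- Firing `other w` exactly `q` times brings the missing 5q chips to `w`; equality of degrees then
-- forces agreement at `other w`.
≡₅⇒~ : ∀ {D E} → degree D ≡ degree E → ∀ w → D w ≡₅ E w → D ~ E
≡₅⇒~ {D} {E} degrees w (mod₅ (divides q p)) = f , λ x →
  trans (correct x) (cong (_+_ (D x)) (sym (Δ-banana f x)))
  where
  open ≡-Reasoning
  f : Fin 2 → ℤ
  f x = q * ⟦ other w ⟧ x
  sums : E w + E (other w) ≡ D w + D (other w)
  sums = trans (sym (degree-banana E w)) (trans (sym degrees) (degree-banana D w))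
  -- `here` and `there` have the values of the indicator in `f` written out as 1 and 0, which suits
  -- the ring solver; `correct` puts the indicator back.
  here : ∀ a b q → b - a ≡ q * + 5 → b ≡ a + (q * 1ℤ - q * 0ℤ) * + 5
  here a b q p = begin
    b                                ≡⟨ lem a b ⟩
    a + (b - a)                      ≡⟨ cong (_+_ a) p ⟩
    a + q * + 5                      ≡⟨ lem′ a q ⟩
    a + (q * 1ℤ - q * 0ℤ) * + 5      ∎
    where
    lem : ∀ a b → b ≡ a + (b - a)
    lem = solve-∀
    lem′ : ∀ a q → a + q * + 5 ≡ a + (q * 1ℤ - q * 0ℤ) * + 5
    lem′ = solve-∀
  there : ∀ a b q a′ b′ → b - a ≡ q * + 5 → b + b′ ≡ a + a′ → b′ ≡ a′ + (q * 0ℤ - q * 1ℤ) * + 5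
  there a b q a′ b′ p s = begin
    b′                               ≡⟨ lem b b′ ⟩
    (b + b′) - b                     ≡⟨ cong (_- b) s ⟩
    (a + a′) - b                     ≡⟨ lem′ a b a′ ⟩
    a′ - (b - a)                     ≡⟨ cong (_-_ a′) p ⟩
    a′ - q * + 5                     ≡⟨ lem″ a′ q ⟩
    a′ + (q * 0ℤ - q * 1ℤ) * + 5     ∎
    where
    lem : ∀ b b′ → b′ ≡ (b + b′) - b
    lem = solve-∀
    lem′ : ∀ a b a′ → (a + a′) - b ≡ a′ - (b - a)
    lem′ = solve-∀
    lem″ : ∀ a′ q → a′ - q * + 5 ≡ a′ + (q * 0ℤ - q * 1ℤ) * + 5
    lem″ = solve-∀
  correct : ∀ x → E x ≡ D x + (f (other x) - f x) * + 5
  correct x with x ≟ w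
  ... | yes refl = subst₂ (λ a b → E w ≡ D w + (q * a - q * b) * + 5)
    (sym (⟦⟧-at (other w))) (sym (⟦other⟧-at w)) (here (D w) (E w) q p)
  ... | no x≢w with ≢⇒≡other w x≢w
  ...   | refl = subst₂ (λ a b → E (other w) ≡ D (other w) + (q * a - q * b) * + 5)
    (trans (sym (⟦other⟧-at w)) (cong ⟦ other w ⟧ (sym (other-other w)))) (sym (⟦⟧-at (other w)))
    (there (D w) (E w) q (D (other w)) (E (other w)) p sums)

-- Spanning trees as single edges.

⁅⁆-injective : ∀ {n} {x y : Fin n} → ⁅ x ⁆ ≡ ⁅ y ⁆ → x ≡ y
⁅⁆-injective {x = x} {y} eq = x∈⁅y⁆⇒x≡y y (subst (x ∈_) eq (x∈⁅x⁆ x))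

-- A non-empty walk in ⁅ e ⁆ without repeated edges is a single step, which changes the vertex
-- because there are no loops; so it never closes up.
singleEdge : ∀ e → IsSpanningTree ⁅ e ⁆
singleEdge e = record
  { treeConnected = connected
  ; treeAcyclic   = λ p c → open-ended p (IsCycle.nonEmpty c) (IsCycle.distinctEdges c) refl
  }
  where
  connected : ∀ u w → Walk ⁅ e ⁆ u w
  connected zero       zero       = []
  connected zero       (suc zero) = step (e , false) (x∈⁅x⁆ e) refl []
  connected (suc zero) zero       = step (e , true) (x∈⁅x⁆ e) refl []
  connected (suc zero) (suc zero) = []
  open-ended : ∀ {u w} (p : Walk ⁅ e ⁆ u w) → ¬ edges p ≡ [] → Unique (edges p) → u ≢ w
  open-ended []                                nonEmpty _ = contradiction refl nonEmpty
  open-ended (step h _ refl [])                _ _        = Graph.loopless banana h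
  open-ended (step _ h∈ _ (step _ h′∈ _ _)) _ ((h≢h′ ∷ _) ∷ _) =
    contradiction (trans (x∈⁅y⁆⇒x≡y e h∈) (sym (x∈⁅y⁆⇒x≡y e h′∈))) h≢h′

-- A walk between the two vertices supplies an edge `e`, and any second edge would form a cycle of
-- length two with it.
isSingleEdge : (T : Tree) → ∃ λ e → proj₁ T ≡ ⁅ e ⁆
isSingleEdge (T , isTree) with IsSpanningTree.treeConnected isTree zero (suc zero)
... | step (e , _) e∈T _ _ = e , ⊆-antisym
  (λ f∈T → subst (_∈ ⁅ e ⁆) (sym (unique f∈T)) (x∈⁅x⁆ e))
  (λ f∈⁅e⁆ → subst (_∈ T) (sym (x∈⁅y⁆⇒x≡y e f∈⁅e⁆)) e∈T)
  where
  unique : ∀ {f} → f ∈ T → f ≡ e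
  unique {f} f∈T with f ≟ e
  ... | yes f≡e = f≡e
  ... | no  f≢e = contradiction
    (record { nonEmpty         = λ ()
            ; distinctEdges    = (f≢e ∷ []) ∷ [] ∷ []
            ; distinctVertices = ((λ ()) ∷ []) ∷ [] ∷ [] })
    (IsSpanningTree.treeAcyclic isTree
      (step (f , false) f∈T refl (step (e , true) e∈T refl [])))

edgeOf : Tree → Fin 5
edgeOf = proj₁ ∘ isSingleEdge

edgeOf-≡ : (T : Tree) → proj₁ T ≡ ⁅ edgeOf T ⁆
edgeOf-≡ = proj₂ ∘ isSingleEdge

-- Cyclic orders given by numbering the edges.

module _ (π : Fin 2 → Permutation′ 5) where

  -- `π w` numbers the edges around `w` from 0 to 4, so that moving along the cyclic order becomes
  -- addition modulo 5.
  pos : Fin 2 → Fin 5 → ℤ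
  pos w e = + toℕ (π w ⟨$⟩ʳ e)

  rotate : Fin 2 → ℤ → Fin 5 → Fin 5
  rotate w k e = π w ⟨$⟩ˡ residue (pos w e + k)

  pos-rotate : ∀ w k e → pos w (rotate w k e) ≡₅ pos w e + k
  pos-rotate w k e = subst (λ i → + toℕ i ≡₅ pos w e + k) (sym (inverseʳ (π w))) (residue≡₅ _)

  pos-injective : ∀ w {e f} → pos w e ≡₅ pos w f → e ≡ f
  pos-injective w p =
    trans (sym (inverseˡ (π w)))
      (trans (cong (π w ⟨$⟩ˡ_) (toℕ-injective₅ _ _ p)) (inverseˡ (π w)))

  -- Positions modulo 5 determine edges. This reduces the identification of an edge with a rotation
  -- to a congruence.
  rotate-unique : ∀ w k {e f} → pos w f ≡₅ pos w e + k → f ≡ rotate w k e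
  rotate-unique w k {e} p = pos-injective w (≡₅-trans p (≡₅-sym (pos-rotate w k e)))

  turn : HalfEdge 5 → HalfEdge 5
  turn (e , s) = rotate (vertex s) 1ℤ e , s

  iterate-turn : ∀ k e s → iterate turn (e , s) k ≡ (rotate (vertex s) (+ k) e , s)
  iterate-turn zero    e s = cong (_, s) (rotate-unique w 0ℤ (≡⇒≡₅ (sym (ℤ.+-identityʳ _))))
    where w = vertex s
  iterate-turn (suc k) e s = trans (iterate-turn k (rotate w 1ℤ e) s)
    (cong (_, s) (rotate-unique w (+ suc k) (≡₅-trans (pos-rotate w (+ k) _)
      (subst (_≡₅_ _) (ℤ.+-assoc (pos w e) 1ℤ (+ k)) (+-congʳ₅ (+ k) (pos-rotate w 1ℤ e))))))
    where w = vertex s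

  turn-cyclic : ∀ h h′ → ends h ≡ ends h′ → ∃ λ k → iterate turn h k ≡ h′
  turn-cyclic (e , s) (e′ , s′) eq with refl ← vertex-injective s s′ eq =
    toℕ k , trans (iterate-turn (toℕ k) e s) (cong (_, s) (sym (rotate-unique w (+ toℕ k) {e}
      (subst (_≡₅ pos w e + + toℕ k) (lem (pos w e) (pos w e′))
        (+-congˡ₅ (pos w e) (≡₅-sym (residue≡₅ (pos w e′ - pos w e))))))))
    where
    w = vertex s
    k = residue (pos w e′ - pos w e)
    lem : ∀ a b → a + (b - a) ≡ b
    lem = solve-∀

  ribbon : RibbonGraph 2
  ribbon = record { graph = banana ; ρ = turn ; at-ρ = λ _ → refl ; cyclic = turn-cyclic }

  -- For both torsors α_v(S , T) depends on S only through its chips at one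
  -- vertex w: the edge of T advances by S w steps in the cyclic order at w.
  act : Fin 2 → Div⁰ banana → Tree → Tree
  act w S T = ⁅ e ⁆ , singleEdge e
    where e = rotate w (proj₁ S w) (edgeOf T)

  act-unique : ∀ w S T {X e} → X ≡ ⁅ e ⁆ → pos w e ≡₅ pos w (edgeOf T) + proj₁ S w →
               X ≡ proj₁ (act w S T)
  act-unique w S T eq p = trans eq (cong ⁅_⁆ (rotate-unique w (proj₁ S w) {edgeOf T} p))

  act-pos : ∀ w S T {X e} → X ≡ ⁅ e ⁆ → X ≡ proj₁ (act w S T) →
            pos w e ≡₅ pos w (edgeOf T) + proj₁ S w
  act-pos w S T eq p = subst (λ e → pos w e ≡₅ _)
    (⁅⁆-injective (trans (sym p) eq)) (pos-rotate w (proj₁ S w) (edgeOf T))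

  -- Rotor routing.

  module Routing (v : Fin 2) where

    private u = other v

    rotorEdge : Rotors ribbon v → Fin 5
    rotorEdge R = edge (R u (other≢ v))

    -- `State` does not force the rotor of `u` to sit at `u`. With this condition a move follows the
    -- order at `u` and sends its chip to `v`.
    Aimed : Rotors ribbon v → Set
    Aimed R = ends (R u (other≢ v)) ≡ u

    -- The invariant of a run modulo 5: a move advances the rotor by one position and removes one
    -- chip from `u`.
    potential : State ribbon v → ℤ
    potential (D , R) = pos u (rotorEdge R) + D u

    isEdgeSet : (R : Rotors ribbon v) → IsEdgeSet ribbon {v} R ⁅ rotorEdge R ⁆
    isEdgeSet R e = mk⇔
      (λ e∈ → u , other≢ v , sym (x∈⁅y⁆⇒x≡y _ e∈))
      (λ { (w , w≢v , eq) → to w w≢v (≢⇒≡other v w≢v) eq })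
      where
      -- Rotors take the proof of `w ≢ v` irrelevantly, so matching on `w ≡ u` already identifies
      -- the two rotors.
      to : ∀ w (w≢v : w ≢ v) → w ≡ u → edge (R w w≢v) ≡ e → e ∈ ⁅ rotorEdge R ⁆
      to _ _ refl refl = x∈⁅x⁆ _

    edgeSet-unique : (R : Rotors ribbon v) → ∀ {X} → IsEdgeSet ribbon {v} R X → X ≡ ⁅ rotorEdge R ⁆
    edgeSet-unique R isX = ⊆-antisym
      (λ {e} → Equivalence.from (isEdgeSet R e) ∘ Equivalence.to (isX e))
      (λ {e} → Equivalence.from (isX e) ∘ Equivalence.to (isEdgeSet R e))

    module _ (D : Divisor 2) (R : Rotors ribbon v) where

      private
        after = route ribbon u (other≢ v) (D , R)
        D′ = proj₁ after
        R′ = proj₂ after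

      route-rotor : R′ u (other≢ v) ≡ turn (R u (other≢ v))
      route-rotor = cong (if_then turn (R u (other≢ v)) else R u (other≢ v)) (dec-true (u ≟ u) refl)

      route-aimed : Aimed R → Aimed R′
      route-aimed aimed = trans (cong ends route-rotor) aimed

      route-chips : Aimed R → D′ u ≡ D u - 1ℤ
      route-chips aimed = trans
        (cong₂ (λ a b → D u - a + b) (⟦⟧-at u) away)
        (ℤ.+-identityʳ _)
        where
        h = R u (other≢ v)
        away : ⟦ ends (opp (turn h)) ⟧ u ≡ 0ℤ
        away = trans (cong (λ w → ⟦ w ⟧ u) (trans (ends-opp (turn h)) (cong other aimed))) (⟦other⟧-at u)

      route-potential : Aimed R → potential after ≡₅ potential (D , R)
      route-potential aimed = ≡₅-trans
        (≡⇒≡₅ (cong₂ _+_ (cong (pos u ∘ edge) route-rotor) (route-chips aimed)))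
        (≡₅-trans (+-congʳ₅ (D u - 1ℤ) advance) (≡⇒≡₅ (lem (pos u (rotorEdge R)) (D u))))
        where
        advance : pos u (edge (turn (R u (other≢ v)))) ≡₅ pos u (rotorEdge R) + 1ℤ
        advance = subst (λ w → pos u (rotate w 1ℤ (rotorEdge R)) ≡₅ pos u (rotorEdge R) + 1ℤ)
          (sym aimed) (pos-rotate u 1ℤ (rotorEdge R))
        lem : ∀ a d → (a + 1ℤ) + (d - 1ℤ) ≡ a + d
        lem = solve-∀

    move-invariant : ∀ {s s′} → Move ribbon s s′ → Aimed (proj₂ s) →
                     Aimed (proj₂ s′) × potential s′ ≡₅ potential s
    -- With two vertices, a move can only choose `u`.
    move-invariant (move {D} {R} w w≢v _) aimed with refl ← ≢⇒≡other v w≢v =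
      route-aimed D R aimed , route-potential D R aimed

    run-potential : ∀ {s s′} → Star (Move ribbon) s s′ → Aimed (proj₂ s) → potential s′ ≡₅ potential s
    run-potential ε       aimed = ≡₅-refl
    run-potential (m ◅ r) aimed with aimed′ , p ← move-invariant m aimed =
      ≡₅-trans (run-potential r aimed′) p

    -- Each move takes one chip from `u` to the basepoint, whence induction on the chips at `u`.
    terminates : ∀ k s → proj₁ s u ≡ + k → Aimed (proj₂ s) →
                 ∃ λ s′ → Star (Move ribbon {v}) s s′ × proj₁ s′ u ≡ 0ℤ
    terminates zero    s       eq aimed = s , ε , eq
    terminates (suc k) (D , R) eq aimed
      with terminates k (route ribbon u (other≢ v) (D , R))
             (trans (route-chips D R aimed) (cong (_- 1ℤ) eq)) (route-aimed D R aimed)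
    ... | s′ , r , done =
      s′ , move u (other≢ v) (subst (0ℤ <_) (sym eq) (+<+ (s≤s z≤n))) ◅ r , done

    -- The potential starts as the position of the edge of `T` plus `S u` modulo 5, and ends as the
    -- position of the final rotor because no chips are left at `u`.
    sound : ∀ {S T X} → RotorRoutes ribbon v S T X → X ≡ proj₁ (act u S T)
    sound {S} {T} {X} routes = act-unique u S T (edgeSet-unique finalRotors finalEdges)
      (subst₂ _≡₅_
        (trans (cong (_+_ (pos u (rotorEdge finalRotors))) (noChips u (other≢ v))) (ℤ.+-identityʳ _))
        (cong (λ e → pos u e + proj₁ S u)
          (⁅⁆-injective (trans (sym (edgeSet-unique rotors edgeSet)) (edgeOf-≡ T))))
        (≡₅-trans (run-potential run (outgoing u (other≢ v)))
                  (+-congˡ₅ (pos u (rotorEdge rotors)) (~⇒≡₅ {chips} represents u))))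
      where
      open RotorRoutes routes
      open Orients orients

    exists : ∀ S T → ∃ λ X → RotorRoutes ribbon v S T X
    exists (S , deg) T = ⁅ rotorEdge R′ ⁆ , record
      { chips       = D
      ; represents  = ≡₅⇒~ {D} {S} (trans (degree-banana D u) (trans total (sym deg))) u
                       (subst (_≡₅ S u) (sym D-u) (residue≡₅ (S u)))
      ; nonNegative = λ w w≢v → subst (λ w → 0ℤ ≤ D w) (sym (≢⇒≡other v w≢v))
                       (subst (0ℤ ≤_) (sym D-u) (+≤+ z≤n))
      ; rotors      = R
      ; orients     = record
        { outgoing = λ w _ → vertex-side w
        ; edgeSet  = subst (IsEdgeSet ribbon {v} R) (sym (edgeOf-≡ T)) (isEdgeSet R)
        ; towards  = towards
        }
      ; finalChips  = proj₁ final
      ; finalRotors = R′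
      ; run         = proj₁ (proj₂ end)
      ; noChips     = λ w w≢v → trans (cong (proj₁ final) (≢⇒≡other v w≢v)) (proj₂ (proj₂ end))
      ; finalEdges  = isEdgeSet R′
      }
      where
      k = toℕ (residue (S u))
      -- Replacing `S u` by its residue gives a class representative that is nonnegative at `u`; the
      -- deficit at `other u`, which is `v`, keeps the degree zero.
      D : Divisor 2
      D x = + k * ⟦ u ⟧ x + - + k * ⟦ other u ⟧ x
      D-u : D u ≡ + k
      D-u = trans (cong₂ (λ a b → + k * a + - + k * b) (⟦⟧-at u) (⟦other⟧-at u)) (lem (+ k))
        where
        lem : ∀ k → k * 1ℤ + - k * 0ℤ ≡ k
        lem = solve-∀
      total : D u + D (other u) ≡ 0ℤ
      total = trans
        (cong₂ _+_ D-u (cong₂ (λ a b → + k * a + - + k * b)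
          (trans (cong (λ w → ⟦ w ⟧ (other u)) (sym (other-other u))) (⟦other⟧-at (other u)))
          (⟦⟧-at (other u))))
        (lem (+ k))
        where
        lem : ∀ k → k + (k * 0ℤ + - k * 1ℤ) ≡ 0ℤ
        lem = solve-∀
      R : Rotors ribbon v
      R w _ = edgeOf T , side w
      towards : ∀ w → Star (λ x y → Σ (x ≢ v) λ x≢v → ends (opp (R x x≢v)) ≡ y) w v
      towards w with w ≟ v
      ... | yes refl = ε
      ... | no  w≢v  = (w≢v , arrives) ◅ ε
        where
        arrives : ends (opp (R w w≢v)) ≡ v
        arrives = trans (ends-opp (R w w≢v))
          (trans (cong other (trans (vertex-side w) (≢⇒≡other v w≢v))) (other-other v))
      end = terminates k (D , R) D-u (vertex-side u)
      final = proj₁ end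
      R′ = proj₂ final

  -- The rotor sits away from the basepoint, hence `other`. For the converse direction one run
  -- suffices, since `sound` determines its outcome.
  rotorRouting-act : IsRotorRouting ribbon (act ∘ other)
  rotorRouting-act v S T X = mk⇔ (sound {S} {T}) λ X≡ →
    let (X′ , routes) = exists S T in
    subst (RotorRoutes ribbon v S T) (trans (sound routes) (sym X≡)) routes
    where open Routing v

  -- Bernardi tours.

  -- The Bernardi divisor D of the tree ⁅ e ⁆, for the tour starting at the
  -- half-edge (f , w), puts one chip on w for each edge passed at w before e.
  record Counts (w : Fin 2) (f e : Fin 5) (D : Divisor 2) : Set where
    constructor counts
    field
      total : degree D ≡ + 4
      steps : pos w f + D w ≡₅ pos w e

  counts? : ∀ w f e D → Dec (Counts w f e D)
  counts? w f e D = map′ (λ (p , q) → counts p q) (λ (counts p q) → p , q)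
    ((degree D ℤ.≟ + 4) ×-dec (pos w f + D w ≡₅? pos w e))

  -- Comparing the two `steps` congruences, equivalence at `w` says that the tree edge advances by
  -- `S w`; the equal totals supply the equality of degrees that equivalence also requires.
  counts-act : ∀ {w f T T′ B B′} S → Counts w f (edgeOf T) B → Counts w f (edgeOf T′) B′ →
               (B′ ~ B ⊕ proj₁ S) ⇔ (proj₁ T′ ≡ proj₁ (act w S T))
  counts-act {w} {f} {T} {T′} {B} {B′} S (counts total steps) (counts total′ steps′) = mk⇔ to from
    where
    open ≡-Reasoning
    shifted : pos w f + (B w + proj₁ S w) ≡₅ pos w (edgeOf T) + proj₁ S w
    shifted = subst (_≡₅ pos w (edgeOf T) + proj₁ S w) (ℤ.+-assoc (pos w f) (B w) (proj₁ S w))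
      (+-congʳ₅ (proj₁ S w) steps)
    degrees : degree B′ ≡ degree (B ⊕ proj₁ S)
    degrees = begin
      degree B′                       ≡⟨ total′ ⟩
      + 4                             ≡⟨ total ⟨
      degree B                        ≡⟨ ℤ.+-identityʳ _ ⟨
      degree B + 0ℤ                   ≡⟨ cong (_+_ (degree B)) (proj₂ S) ⟨
      degree B + degree (proj₁ S)     ≡⟨ ∑-distrib-+ ℤ.+-0-commutativeMonoid B (proj₁ S) ⟨
      degree (B ⊕ proj₁ S)            ∎
    to : B′ ~ B ⊕ proj₁ S → proj₁ T′ ≡ proj₁ (act w S T)
    to B′~ = act-unique w S T (edgeOf-≡ T′)
      (≡₅-trans (≡₅-sym steps′) (≡₅-trans (+-congˡ₅ (pos w f) (~⇒≡₅ {B′} B′~ w)) shifted))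
    from : proj₁ T′ ≡ proj₁ (act w S T) → B′ ~ B ⊕ proj₁ S
    from T′≡ = ≡₅⇒~ {B′} degrees w (+-cancelˡ₅ (pos w f)
      (≡₅-trans steps′ (≡₅-trans (act-pos w S T (edgeOf-≡ T′) T′≡) (≡₅-sym shifted))))

  -- For a concrete `π` this is decided by running the 25 tours that start at `vertex s`; for
  -- general `π` it enters as a hypothesis.
  BernardiCounts : Bool → Set
  BernardiCounts s = ∀ e f → Counts (vertex s) f e (bernardiDivisor ribbon ⁅ e ⁆ (f , s))

  bernardiCounts? : ∀ s → Dec (BernardiCounts s)
  bernardiCounts? s = all? λ e → all? λ f →
    counts? (vertex s) f e (bernardiDivisor ribbon ⁅ e ⁆ (f , s))

  bernardi-act : (∀ s → BernardiCounts s) → IsBernardi ribbon act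
  bernardi-act bernardiCounts _ S T T′ h@(f , s) refl =
    counts-act {T = T} {T′} S (tourCounts T) (tourCounts T′)
    where
    tourCounts : ∀ T → Counts (vertex s) f (edgeOf T) (bernardiDivisor ribbon (proj₁ T) h)
    tourCounts T = subst (λ X → Counts (vertex s) f (edgeOf T) (bernardiDivisor ribbon X h))
      (sym (edgeOf-≡ T)) (bernardiCounts s (edgeOf T) f)

-- The two concrete pairs of cyclic orders.

doubling : Permutation′ 5
-- Multiplication by 3 inverts multiplication by 2 modulo 5.
doubling = permutation (times 2) (times 3)
  (from-yes (all? λ i → times 2 (times 3 i) ≟ i))
  (from-yes (all? λ i → times 3 (times 2 i) ≟ i))
  where
  times : ℕ → Fin 5 → Fin 5
  times k i = residue (+ k * + toℕ i)

doubling≡₅ : ∀ i → + toℕ i + + toℕ i ≡₅ + toℕ (doubling ⟨$⟩ʳ i)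
doubling≡₅ = from-yes (all? λ i → + toℕ i + + toℕ i ≡₅? + toℕ (doubling ⟨$⟩ʳ i))

-- Doubling positions modulo 5 turns ρ into ρ³, whose square is ρ.
order doubledOrder : Fin 2 → Permutation′ 5
order zero       = idₚ
order (suc zero) = transpose (# 1) (# 2) ∘ₚ transpose (# 3) (# 4)
doubledOrder w = order w ∘ₚ doubling

order-counts : ∀ s → BernardiCounts order s
order-counts false = from-yes (bernardiCounts? order false)
order-counts true  = from-yes (bernardiCounts? order true)

doubledOrder-counts : ∀ s → BernardiCounts doubledOrder s
doubledOrder-counts false = from-yes (bernardiCounts? doubledOrder false)
doubledOrder-counts true  = from-yes (bernardiCounts? doubledOrder true)

-- Faces and genus.

module _ (π : Fin 2 → Permutation′ 5) {k} (label : HalfEdge 5 → Fin k) (rep : Fin k → HalfEdge 5) where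

  private
    face′ = face (ribbon π)

  -- A finite certificate for the orbits of `face`: labels are constant along faces, and each
  -- half-edge is joined to its representative in both directions, which avoids inverting `face`.
  -- With ten half-edges, fewer than ten steps reach any point of an orbit.
  Labels : Bool → Set
  Labels s = ∀ e → let h = (e , s) in
    label (face′ h) ≡ label h ×
    (∃ λ i → iterate face′ h (toℕ {10} i) ≡ rep (label h)) ×
    (∃ λ i → iterate face′ (rep (label h)) (toℕ {10} i) ≡ h)

  labels? : ∀ s → Dec (Labels s)
  labels? s = all? λ e → let h = (e , s) in
    (label (face′ h) ≟ label h)
    ×-dec (any? λ i → iterate face′ h (toℕ i) ≟ₕ rep (label h))
    ×-dec (any? λ i → iterate face′ (rep (label h)) (toℕ i) ≟ₕ h)

  hasCycles : (∀ i → label (rep i) ≡ i) → (∀ s → Labels s) → HasCycles (ribbon π) k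
  hasCycles label-rep labels = mk↠ₛ {to = label} (λ i → rep i , label-rep i) ,
    λ h h′ → mk⇔ (to h h′) (λ (i , eq) → trans (sym (invariant i h)) (cong label eq))
    where
    invariant : ∀ i h → label (iterate face′ h i) ≡ label h
    invariant zero    h       = refl
    invariant (suc i) (e , s) = trans (invariant i (face′ (e , s))) (proj₁ (labels s e))
    iterate-+ : ∀ i j h → iterate face′ h (i ℕ.+ j) ≡ iterate face′ (iterate face′ h i) j
    iterate-+ zero    j h = refl
    iterate-+ (suc i) j h = iterate-+ i j (face′ h)
    to : ∀ h h′ → label h ≡ label h′ → ∃ λ i → iterate face′ h i ≡ h′
    to (e , s) (e′ , s′) eq with labels s e | labels s′ e′
    ... | _ , (i , p) , _ | _ , _ , (j , q) = toℕ i ℕ.+ toℕ j ,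
      trans (iterate-+ (toℕ i) (toℕ j) (e , s))
        (trans (cong (λ h → iterate face′ h (toℕ j)) (trans p (cong rep eq))) q)

-- The faces have 6, 2 and 2 half-edges. The short ones come from the edge pairs 1, 2 and 3, 4,
-- which are consecutive in opposite senses at the two vertices.
order-genus : HasGenus (ribbon order) 1
order-genus = 3 , hasCycles order label rep (from-yes (all? λ i → label (rep i) ≟ i)) labels , refl
  where
  label : HalfEdge 5 → Fin 3
  label (zero                         , _) = # 0
  label (suc zero                     , s) = if s then # 1 else # 0
  label (suc (suc zero)               , s) = if s then # 0 else # 1
  label (suc (suc (suc zero))         , s) = if s then # 2 else # 0
  label (suc (suc (suc (suc zero)))   , s) = if s then # 0 else # 2
  rep : Fin 3 → HalfEdge 5
  rep zero             = # 0 , false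
  rep (suc zero)       = # 2 , false
  rep (suc (suc zero)) = # 4 , false
  labels : ∀ s → Labels order label rep s
  labels false = from-yes (labels? order label rep false)
  labels true  = from-yes (labels? order label rep true)

-- All ten half-edges lie on one face.
doubledOrder-genus : HasGenus (ribbon doubledOrder) 2
doubledOrder-genus = 1 , hasCycles doubledOrder label rep (λ { zero → refl }) labels , refl
  where
  label : HalfEdge 5 → Fin 1
  label _ = zero
  rep : Fin 1 → HalfEdge 5
  rep _ = # 0 , false
  labels : ∀ s → Labels doubledOrder label rep s
  labels false = from-yes (labels? doubledOrder label rep false)
  labels true  = from-yes (labels? doubledOrder label rep true)

-- Doubling as an automorphism of the Picard group.

module Pic = AbelianGroup (Pic⁰ banana)

double : Div⁰ banana → Div⁰ banana
double S = S Pic.∙ S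

double-isomorphism : IsGroupIsomorphism Pic.rawGroup Pic.rawGroup double
double-isomorphism = record
  { isGroupMonomorphism = record
    { isGroupHomomorphism = record
      { isMonoidHomomorphism = record
        { isMagmaHomomorphism = record
          { isRelHomomorphism = record { cong = λ {S} {S′} p → double-cong S S′ p }
          ; homo              = λ S S′ → interchange S S′ S S′
          }
        ; ε-homo = Pic.identityˡ Pic.ε
        }
      ; ⁻¹-homo = λ S → ⁻¹-∙-comm S S
      }
    ; injective = λ {S} {S′} p → ≡₅⇒~ {proj₁ S} (trans (proj₂ S) (sym (proj₂ S′))) zero
        (double-cancel₅ (~⇒≡₅ {proj₁ (double S)} p zero))
    }
  -- Tripling inverts doubling, as 6 is 1 modulo 5.
  ; surjective = λ S → triple S , λ {S′} p →
      Pic.trans {double S′} {double (triple S)} {S} (double-cong S′ (triple S) p) (double-triple S)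
  }
  where
  open AbelianGroupProperties (Pic⁰ banana) using (⁻¹-∙-comm)
  open CommutativeSemigroupProperties Pic.commutativeSemigroup using (interchange)
  double-cong : ∀ S S′ → S Pic.≈ S′ → double S Pic.≈ double S′
  double-cong S S′ p = Pic.∙-cong {S} {S′} {S} {S′} p p
  triple : Div⁰ banana → Div⁰ banana
  triple S = S Pic.∙ (S Pic.∙ S)
  double-triple : ∀ S → double (triple S) Pic.≈ S
  double-triple S = ≡₅⇒~ {proj₁ (double (triple S))}
    (trans (proj₂ (double (triple S))) (sym (proj₂ S))) zero (mod₅ (divides (- a) (lem a)))
    where
    a = proj₁ S zero
    lem : ∀ a → a - (a + (a + a) + (a + (a + a))) ≡ - a * + 5
    lem = solve-∀

-- Compatibility of the torsors.

-- Positions in `doubledOrder` are twice those in `order` modulo 5, so an advance by `S w` in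
-- `order` is an advance by twice `S w` in `doubledOrder`.
act-double : ∀ w S T → proj₁ (act order w S T) ≡ proj₁ (act doubledOrder w (double S) T)
act-double w S T = act-unique doubledOrder w (double S) T refl
  (≡₅-trans (≡₅-sym (doubling≡₅ (order w ⟨$⟩ʳ e′)))
    (≡₅-trans (+-congˡ₅ (pos order w e′) rotated)
      (≡₅-trans (+-congʳ₅ (pos order w e + k) rotated)
        (subst (_≡₅ pos doubledOrder w e + (k + k)) (lem (pos order w e) k)
          (+-congʳ₅ (k + k) (doubling≡₅ (order w ⟨$⟩ʳ e)))))))
  where
  e  = edgeOf T
  k  = proj₁ S w
  e′ = rotate order w k e
  rotated = pos-rotate order w k e
  lem : ∀ a k → (a + a) + (k + k) ≡ (a + k) + (a + k)
  lem = solve-∀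

-- The vertex whose cyclic order moves the tree edge: the rotor's vertex for rotor routing, the
-- start of the tour for Bernardi.
pivot : TorsorKind → Fin 2 → Fin 2
pivot rotorRouting = other
pivot bernardi     = λ v → v

act-torsor : ∀ κ π → (∀ s → BernardiCounts π s) → IsTorsorOf κ (ribbon π) (λ v → act π (pivot κ v))
act-torsor rotorRouting π _ = rotorRouting-act π
act-torsor bernardi     π c = bernardi-act π c

theorem1p5 : (κ : TorsorKind) →
    Σ ℕ λ n → Σ (RibbonGraph n) λ G → Σ (RibbonGraph n) λ G′ →
    Σ ℕ λ g → Σ ℕ λ g′ → HasGenus G g × HasGenus G′ g′ ×
    (Σ (Action G) λ α → Σ (Action G′) λ α′ → IsTorsorOf κ G α × IsTorsorOf κ G′ α′ ×
    (Σ (Bijection (𝒯 G) (𝒯 G′)) λ φ →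
    Σ (Div⁰ (graph G) → Div⁰ (graph G′)) λ γ →
    IsGroupIsomorphism (rawGroup (Pic⁰ (graph G))) (rawGroup (Pic⁰ (graph G′))) γ ×
    ((v : Fin n) (S : Div⁰ (graph G)) (T : SpanningTree G) →
    Eq (𝒯 G′) (Bijection.to φ (α v S T)) (α′ v (γ S) (Bijection.to φ T))) ×
    (g ≢ g′)))
theorem1p5 κ =
  2 , ribbon order , ribbon doubledOrder , 1 , 2 , order-genus , doubledOrder-genus ,
  (λ v → act order (pivot κ v)) , (λ v → act doubledOrder (pivot κ v)) ,
  act-torsor κ order order-counts , act-torsor κ doubledOrder doubledOrder-counts ,
  Identity.bijection (𝒯 (ribbon order)) ,
  double , double-isomorphism , (λ v → act-double (pivot κ v)) , λ ()
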